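{- Let $P$ be a finite partially ordered set with $n$ elements, let $Z_P$ be its zeta matrix and $\mathfrak{Z}_P = Z_P + Z_P^t$. For $1\le s\le n$ let $c_s$ be the number of collections of pairwise disjoint directed cycles in the directed graph $\overline{D_P}$ that consist of precisely $s$ cycles (i.e. have precisely $s$ connected components) and that together contain all the vertices of $\overline{D_P}$. Then $$\det(\mathfrak{Z}_P) = \sum_{s=1}^n (-1)^{n-s} c_s .$$
   Context: For a finite poset $P$ with $n$ elements labelled $x_1,\ldots,x_n$ so that $x_i < x_j$ implies $i<j$, the zeta matrix $Z_P$ is the $n\times n$ matrix with $(Z_P)_{ij}=1$ if $x_i\le x_j$ and $(Z_P)_{ij}=0$ otherwise; the superscript $t$ denotes transpose. The directed graph $D_P$ has vertex set $P$ and, for each pair of distinct comparable elements $x,y\in P$, one directed edge from $x$ to $y$ and one directed edge from $y$ to $x$; it has no loops. The directed graph $\overline{D_P}$ is obtained from $D_P$ by adding two (distinct) loops at each vertex. Directed cycles in $\overline{D_P}$ are simple directed cycles: a cycle of length $1$ is a loop (so each vertex carries two different cycles of length $1$), a cycle of length $2$ is $x\to y\to x$ for distinct comparable $x,y$, and for length at least $3$ the two orientations of a cyclic sequence of vertices count as different cycles. Cycles are disjoint if they share no vertices, and collections are unordered. -}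

module Defs where

open import Level using (Level; _⊔_; suc)
open import Algebra.Definitions.RawMonoid using (sum)
open import Data.Bool.Base using (if_then_else_)
open import Data.Fin.Base as Fin using (Fin; toℕ; punchIn)
open import Data.Integer.Base using (ℤ; 0ℤ; 1ℤ; -1ℤ; _+_; _*_; _^_; +-0-rawMonoid)
open import Data.List.Base using (List; []; _∷_; _++_; _∷ʳ_; map; length)
open import Data.List.Membership.Propositional using (_∈_)
open import Data.List.Properties using (++-assoc; ++-identityʳ; ∷-injective)
import Data.List.Relation.Binary.Disjoint.Propositional as List
import Data.List.Relation.Binary.Permutation.Setoid as Permutation
open import Data.List.Relation.Unary.AllPairs using (AllPairs)
open import Data.List.Relation.Unary.Any using (Any)
open import Data.List.Relation.Unary.Unique.Propositional using (Unique)
open import Data.Nat.Base as ℕ using (ℕ)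
open import Data.Product.Base using (_×_; _,_; ∃-syntax; ∃₂)
open import Data.Sum.Base using (_⊎_; inj₁; inj₂; [_,_]′)
open import Function.Base using (flip)
open import Function.Bundles using (Inverse; _↔_)
open import Relation.Binary.Bundles using (Setoid)
open import Relation.Binary.Core using (Rel)
open import Relation.Binary.Definitions using (Reflexive; Symmetric; Transitive)
open import Relation.Binary.PropositionalEquality
  using (_≡_; _≢_; refl; sym; trans; cong; setoid)
open import Relation.Binary.Structures using (IsDecPartialOrder)
import Relation.Binary.Construct.On as On
open import Relation.Nullary.Decidable.Core using (does)

private variable
  a v e p ℓ : Level
  n : ℕ

HasCardinality : Setoid a ℓ → ℕ → Set (a ⊔ ℓ)
HasCardinality S m = Inverse S (setoid (Fin m))

------------------------------------------------------------------------
-- Integer matrices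

∑ : (Fin n → ℤ) → ℤ
∑ = sum +-0-rawMonoid

Matrix : ℕ → Set
Matrix n = Fin n → Fin n → ℤ

infixl 6 _⊕_
infix 8 _ᵗ

_⊕_ : Matrix n → Matrix n → Matrix n
(A ⊕ B) i j = A i j + B i j

_ᵗ : Matrix n → Matrix n
A ᵗ = flip A

-- Expansion along the first row; `punchIn j` skips column j.
det : Matrix n → ℤ
det {ℕ.zero}  A = 1ℤ
det {ℕ.suc n} A =
  ∑ λ j → -1ℤ ^ toℕ j * (A Fin.zero j * det (λ i k → A (Fin.suc i) (punchIn j k)))

------------------------------------------------------------------------
-- Posets with n elements labelled compatibly with the order

-- Decidability of the order is what makes the zeta matrix definable
-- constructively; classically it is automatic.
record LabelledPoset (p ℓ : Level) (n : ℕ) : Set (suc (p ⊔ ℓ)) where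
  field
    Carrier           : Set p
    _≤_               : Rel Carrier ℓ
    isDecPartialOrder : IsDecPartialOrder _≡_ _≤_
    labelling         : Fin n ↔ Carrier

  open IsDecPartialOrder isDecPartialOrder public using (_≤?_)

  x : Fin n → Carrier
  x = Inverse.to labelling

  field
    natural : ∀ {i j} → x i ≤ x j → x i ≢ x j → i Fin.< j

zeta : LabelledPoset p ℓ n → Matrix n
zeta P i j = if does (x i ≤? x j) then 1ℤ else 0ℤ
  where open LabelledPoset P

------------------------------------------------------------------------
-- Directed graphs, with loops and parallel edges allowed

record Digraph (v e : Level) : Set (suc (v ⊔ e)) where
  field
    Vertex : Set v
    Edge   : Set e
    source : Edge → Vertex
    target : Edge → Vertex

-- The irrelevant fields ensure that there is exactly one edge for each
-- ordered pair of distinct comparable elements.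
record ComparabilityEdge {A : Set p} (_≤_ : Rel A ℓ) : Set (p ⊔ ℓ) where
  constructor arc
  field
    from        : A
    to          : A
    .distinct   : from ≢ to
    .comparable : from ≤ to ⊎ to ≤ from

D : LabelledPoset p ℓ n → Digraph p (p ⊔ ℓ)
D P = record
  { Vertex = Carrier
  ; Edge   = ComparabilityEdge _≤_
  ; source = ComparabilityEdge.from
  ; target = ComparabilityEdge.to
  }
  where open LabelledPoset P

addTwoLoops : Digraph v e → Digraph v (v ⊔ e)
addTwoLoops G = record
  { Vertex = Vertex
  ; Edge   = Edge ⊎ (Vertex × Fin 2)
  ; source = [ source , (λ (u , _) → u) ]′
  ; target = [ target , (λ (u , _) → u) ]′
  }
  where open Digraph G

D̄ : LabelledPoset p ℓ n → Digraph p (p ⊔ ℓ)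
D̄ P = addTwoLoops (D P)

------------------------------------------------------------------------
-- Lists up to rotation

infix 4 _~_

_~_ : {A : Set a} → Rel (List A) a
xs ~ ys = ∃₂ λ as bs → xs ≡ as ++ bs × ys ≡ bs ++ as

private
  split : {A : Set a} (as {bs} cs {ds} : List A) → as ++ bs ≡ cs ++ ds →
          (∃[ es ] cs ≡ as ++ es × bs ≡ es ++ ds) ⊎
          (∃[ es ] as ≡ cs ++ es × ds ≡ es ++ bs)
  split []       cs       eq = inj₁ (_ , refl , eq)
  split (a ∷ as) []       eq = inj₂ (_ , refl , sym eq)
  split (a ∷ as) (c ∷ cs) eq with ∷-injective eq
  ... | refl , eq′ with split as cs eq′
  ...   | inj₁ (es , cs≡ , bs≡) = inj₁ (es , cong (a ∷_) cs≡ , bs≡)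
  ...   | inj₂ (es , as≡ , ds≡) = inj₂ (es , cong (a ∷_) as≡ , ds≡)

~-refl : {A : Set a} → Reflexive (_~_ {A = A})
~-refl {x = xs} = [] , xs , refl , sym (++-identityʳ xs)

~-sym : {A : Set a} → Symmetric (_~_ {A = A})
~-sym (as , bs , xs≡ , ys≡) = bs , as , ys≡ , xs≡

~-trans : {A : Set a} → Transitive (_~_ {A = A})
~-trans (as , bs , refl , refl) (cs , ds , ys≡ , refl) with split bs cs ys≡
... | inj₁ (es , refl , refl) =
      es , ds ++ bs , ++-assoc es ds bs , sym (++-assoc ds bs es)
... | inj₂ (es , refl , refl) =
      as ++ cs , es , sym (++-assoc as cs es) , ++-assoc es as cs

------------------------------------------------------------------------
-- Simple directed cycles and vertex-disjoint cycle collections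

module _ (G : Digraph v e) where
  open Digraph G

  -- A cycle of length 1 + length rest, traversed from the source of its
  -- first edge.  By `closed` each edge ends where its cyclic successor
  -- starts, and by `simple` no vertex is visited twice.
  record Cycle : Set (v ⊔ e) where
    field
      first : Edge
      rest  : List Edge

    edges : List Edge
    edges = first ∷ rest

    vertices : List Vertex
    vertices = map source edges

    field
      closed : map target edges ≡ map source (rest ∷ʳ first)
      simple : Unique vertices

  open Cycle using (edges; vertices)

  -- Cycles are identified when they differ only in the starting point.
  cycleSetoid : Setoid (v ⊔ e) e
  cycleSetoid = record
    { Carrier       = Cycle
    ; _≈_           = λ C C′ → edges C ~ edges C′
    ; isEquivalence = record { refl = ~-refl ; sym = ~-sym ; trans = ~-trans }
    }

  record CycleCover (s : ℕ) : Set (v ⊔ e) where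
    field
      cycles   : List Cycle
      size     : length cycles ≡ s
      disjoint : AllPairs (λ C C′ → List.Disjoint (vertices C) (vertices C′)) cycles
      covers   : ∀ u → Any (λ C → u ∈ vertices C) cycles

  -- Collections are unordered.  Repeated cycles are already excluded by
  -- `disjoint`, since every cycle has a vertex.
  cycleCoverSetoid : ℕ → Setoid (v ⊔ e) (v ⊔ e)
  cycleCoverSetoid s =
    On.setoid (Permutation.↭-setoid cycleSetoid) (CycleCover.cycles {s})

-- Every cover has a unique canonical form: its cycles start at their first
-- vertex in the labelling and are listed in the order of these vertices.
-- Canonical covers are built edge by edge.  If a cycle begun at m has reached v
-- and the vertices us are unused, then either an edge v → m closes it, or an
-- edge v → w with w in us prolongs it.  The minor d(v, m, us) with rows v ∷ us
-- and columns m ∷ us obeys the same recursion: expanding along row v gives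
--   d(v, m, us) = M v m · minor us us − Σ_w M v w · d(w, m, us ∖ w),
-- since moving row w to the front absorbs the alternating sign.  Hence each
-- prolonging edge contributes −1, and a cover with s cycles has n − s of them.

module Submission where

open import Defs
open import Data.Fin.Base using (toℕ)
open import Data.Integer.Base using (+_; -1ℤ; _*_; _^_)
open import Data.Nat.Base using (ℕ; suc; _∸_; _≤_; NonZero)
open import Data.Product.Base using (_×_; Σ-syntax)
open import Relation.Binary.PropositionalEquality using (_≡_)

import Algebra.Properties.CommutativeMonoid.Sum as Sum
import Algebra.Properties.Semiring.Sum as SemiringSum
open import Data.Bool.Base using (true; false; if_then_else_)
open import Data.Empty using (⊥-elim-irr)
open import Data.Fin.Base as Fin using (Fin; punchIn)
open import Data.Fin.Properties using (toℕ<n)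
open import Data.Integer.Base using (ℤ; 0ℤ; 1ℤ; _+_; -_; _-_)
import Data.Integer.Properties as ℤ
open import Data.Integer.Tactic.RingSolver using (solve-∀)
open import Data.List.Base
  using (List; []; _∷_; _++_; _∷ʳ_; map; length; lookup; filter; tabulate; concat; concatMap; cartesianProductWith)
open import Data.List.Membership.Propositional using (_∈_; lose)
open import Data.List.Membership.Propositional.Properties
open import Data.List.Membership.Propositional.Properties.WithK using (unique∧set⇒bag)
open import Data.List.Properties
  using (∷-injective; ∷-injectiveˡ; ∷-injectiveʳ; length-++; length-map; length-tabulate; map-++; map-∘; map-concatMap)
open import Data.List.Relation.Binary.BagAndSetEquality using (∼bag⇒↭)
open import Data.List.Relation.Binary.Disjoint.Propositional using (Disjoint)
open import Data.List.Relation.Binary.Permutation.Propositional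
open import Data.List.Relation.Binary.Permutation.Propositional.Properties
import Data.List.Relation.Binary.Permutation.Setoid as Permutationₛ
import Data.List.Relation.Binary.Permutation.Setoid.Properties as Permutationₛₚ
open import Data.List.Relation.Binary.Pointwise using (Pointwise; []; _∷_)
open import Data.List.Relation.Unary.All as All using (All; []; _∷_)
import Data.List.Relation.Unary.All.Properties as All
open import Data.List.Relation.Unary.AllPairs as AllPairs using (AllPairs; []; _∷_)
import Data.List.Relation.Unary.AllPairs.Properties as AllPairs
open import Data.List.Relation.Unary.Any as Any using (Any; here; there)
import Data.List.Relation.Unary.Any.Properties as Any
open import Data.List.Relation.Unary.Unique.Propositional using (Unique)
open import Data.List.Relation.Unary.Unique.Propositional.Properties using (Unique[x∷xs]⇒x∉xs; concat⁺; tabulate⁺)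
open import Data.Nat.Base as ℕ using (zero)
import Data.Nat.Properties as ℕ
open import Data.Product.Base using (_,_; proj₁; proj₂; ∃₂; ∃-syntax; uncurry)
open import Data.Sum.Base using (inj₁; inj₂)
open import Function.Base using (_∘_; _on_)
open import Function.Bundles using (Inverse; mk⇔)
open import Level using (Level; _⊔_)
open import Relation.Binary.Bundles using (Setoid)
open import Relation.Binary.Core using (Rel)
open import Relation.Binary.Definitions using (Symmetric)
open import Relation.Binary.PropositionalEquality as ≡ using (_≢_; cong; cong₂; subst; subst₂; module ≡-Reasoning)
open import Relation.Binary.Structures using (IsDecPartialOrder)
open import Relation.Nullary using (¬_; contradiction; does; yes; no)
open import Relation.Nullary.Decidable using (_⊎-dec_)
open import Relation.Unary using (Decidable)

open Sum ℤ.+-0-commutativeMonoid using (sum-cong-≗; sum-replicate-zero; ∑-distrib-+)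
open SemiringSum ℤ.+-*-semiring using (*-distribˡ-sum)

private variable
  a p r ℓ : Level
  A B : Set a

-- Minors indexed by lists of rows and columns

∑ˡ : (A → ℤ) → List A → ℤ
∑ˡ f []       = 0ℤ
∑ˡ f (x ∷ xs) = f x + ∑ˡ f xs

∑ˡ-cong : ∀ {f g : A → ℤ} xs → (∀ {x} → x ∈ xs → f x ≡ g x) → ∑ˡ f xs ≡ ∑ˡ g xs
∑ˡ-cong []       f≡g = ≡.refl
∑ˡ-cong (x ∷ xs) f≡g = cong₂ _+_ (f≡g (here ≡.refl)) (∑ˡ-cong xs (f≡g ∘ there))

∑ˡ-++ : ∀ (f : A → ℤ) xs {ys} → ∑ˡ f (xs ++ ys) ≡ ∑ˡ f xs + ∑ˡ f ys
∑ˡ-++ f []       = ≡.sym (ℤ.+-identityˡ _)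
∑ˡ-++ f (x ∷ xs) = ≡.trans (cong (_+_ (f x)) (∑ˡ-++ f xs)) (≡.sym (ℤ.+-assoc (f x) _ _))

∑ˡ-map : ∀ (f : B → ℤ) (g : A → B) xs → ∑ˡ f (map g xs) ≡ ∑ˡ (f ∘ g) xs
∑ˡ-map f g []       = ≡.refl
∑ˡ-map f g (x ∷ xs) = cong (_+_ (f (g x))) (∑ˡ-map f g xs)

∑ˡ-concatMap : ∀ (f : B → ℤ) (g : A → List B) xs → ∑ˡ f (concatMap g xs) ≡ ∑ˡ (∑ˡ f ∘ g) xs
∑ˡ-concatMap f g []       = ≡.refl
∑ˡ-concatMap f g (x ∷ xs) = ≡.trans (∑ˡ-++ f (g x)) (cong (_+_ (∑ˡ f (g x))) (∑ˡ-concatMap f g xs))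

∑ˡ-*ˡ : ∀ c (f : A → ℤ) xs → ∑ˡ (λ x → c * f x) xs ≡ c * ∑ˡ f xs
∑ˡ-*ˡ c f []       = ≡.sym (ℤ.*-zeroʳ c)
∑ˡ-*ˡ c f (x ∷ xs) = ≡.trans (cong (_+_ (c * f x)) (∑ˡ-*ˡ c f xs)) (≡.sym (ℤ.*-distribˡ-+ c (f x) _))

-- In f c r, the list r is what remains after removing c.
∑± : (A → List A → ℤ) → List A → ℤ
∑± f []       = 0ℤ
∑± f (c ∷ cs) = f c cs - ∑± (λ d r → f d (c ∷ r)) cs

∑±-cong : {f g : A → List A → ℤ} → (∀ c r → f c r ≡ g c r) → ∀ cs → ∑± f cs ≡ ∑± g cs
∑±-cong f≗g []       = ≡.refl
∑±-cong f≗g (c ∷ cs) = cong₂ _-_ (f≗g c cs) (∑±-cong (λ d r → f≗g d (c ∷ r)) cs)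

∑±-neg : ∀ (f : A → List A → ℤ) cs → ∑± (λ c r → - f c r) cs ≡ - ∑± f cs
∑±-neg f []       = ≡.refl
∑±-neg f (c ∷ cs) =
  ≡.trans (cong (_-_ (- f c cs)) (∑±-neg (λ d r → f d (c ∷ r)) cs)) (≡.sym (ℤ.neg-distrib-+ (f c cs) _))

∑±-distrib-- : ∀ (f g : A → List A → ℤ) cs → ∑± (λ c r → f c r - g c r) cs ≡ ∑± f cs - ∑± g cs
∑±-distrib-- f g []       = ≡.refl
∑±-distrib-- f g (c ∷ cs) =
  ≡.trans (cong (_-_ (f c cs - g c cs)) (∑±-distrib-- (λ d r → f d (c ∷ r)) (λ d r → g d (c ∷ r)) cs))
          (lemma (f c cs) (g c cs) _ _)
  where
  lemma : ∀ x y s t → (x - y) - (s - t) ≡ (x - s) - (y - t)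
  lemma = solve-∀

∑±-*ˡ : ∀ k (f : A → List A → ℤ) cs → ∑± (λ c r → k * f c r) cs ≡ k * ∑± f cs
∑±-*ˡ k f []       = ≡.sym (ℤ.*-zeroʳ k)
∑±-*ˡ k f (c ∷ cs) =
  ≡.trans (cong (_-_ (k * f c cs)) (∑±-*ˡ k (λ d r → f d (c ∷ r)) cs)) (lemma k (f c cs) _)
  where
  lemma : ∀ k x s → k * x - k * s ≡ k * (x - s)
  lemma = solve-∀

-- Removing the earlier of two entries moves the later one up by one position, so choosing the same
-- two entries in the opposite order reverses the sign.
∑±-swap : ∀ (f : A → A → List A → ℤ) cs →
  ∑± (λ c → ∑± (f c)) cs ≡ - ∑± (λ c → ∑± (λ d → f d c)) cs
∑±-swap f []       = ≡.refl
∑±-swap f (c ∷ cs) = begin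
  ∑± (f c) cs - ∑± (λ d r → f d c r - ∑± (λ e r′ → f d e (c ∷ r′)) r) cs
    ≡⟨ cong (_-_ (∑± (f c) cs)) (∑±-distrib-- (λ d → f d c) (λ d → ∑± (λ e r′ → f d e (c ∷ r′))) cs) ⟩
  ∑± (f c) cs - (∑± (λ d → f d c) cs - ∑± (λ d → ∑± (λ e r′ → f d e (c ∷ r′))) cs)
    ≡⟨ cong (λ t → ∑± (f c) cs - (∑± (λ d → f d c) cs - t)) (∑±-swap (λ d e r → f d e (c ∷ r)) cs) ⟩
  ∑± (f c) cs - (∑± (λ d → f d c) cs - - t)
    ≡⟨ lemma (∑± (f c) cs) (∑± (λ d → f d c) cs) t ⟩
  - (∑± (λ d → f d c) cs - (∑± (f c) cs - t))
    ≡⟨ cong (λ s → - (∑± (λ d → f d c) cs - s)) (≡.sym (∑±-distrib-- (f c) (λ d → ∑± (λ e r′ → f e d (c ∷ r′))) cs)) ⟩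
  - (∑± (λ d → f d c) cs - ∑± (λ d r → f c d r - ∑± (λ e r′ → f e d (c ∷ r′)) r) cs) ∎
  where
  open ≡-Reasoning
  t = ∑± (λ d → ∑± (λ e r → f e d (c ∷ r))) cs
  lemma : ∀ p q t → p - (q - - t) ≡ - (q - (p - t))
  lemma = solve-∀

picks : List A → List (A × List A)
picks []       = []
picks (u ∷ us) = (u , us) ∷ map (λ (w , r) → w , u ∷ r) (picks us)

-- Bringing the chosen row to the front cancels the alternating signs.
∑±-picks : ∀ (H : A → List A → List A → ℤ) →
  (∀ d r p x y rs → H d r (p ++ x ∷ y ∷ rs) ≡ - H d r (p ++ y ∷ x ∷ rs)) → ∀ us →
  ∑± (λ c r → H c r us) us ≡ ∑ˡ (λ (w , r) → H w r (w ∷ r)) (picks us)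
∑±-picks H alternating []       = ≡.refl
∑±-picks H alternating (u ∷ us) = cong (_+_ (H u us (u ∷ us))) (begin
  - ∑± (λ c r → H c (u ∷ r) (u ∷ us)) us
    ≡⟨ cong -_ (∑±-picks (λ c r rs → H c (u ∷ r) (u ∷ rs))
                         (λ d r p → alternating d (u ∷ r) (u ∷ p)) us) ⟩
  - ∑ˡ (λ (w , r) → H w (u ∷ r) (u ∷ w ∷ r)) (picks us)
    ≡⟨ ℤ.-1*i≡-i _ ⟨
  -1ℤ * ∑ˡ (λ (w , r) → H w (u ∷ r) (u ∷ w ∷ r)) (picks us)
    ≡⟨ ∑ˡ-*ˡ -1ℤ _ (picks us) ⟨
  ∑ˡ (λ (w , r) → -1ℤ * H w (u ∷ r) (u ∷ w ∷ r)) (picks us)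
    ≡⟨ ∑ˡ-cong (picks us) (λ {(w , r)} _ → ≡.trans (ℤ.-1*i≡-i _) (≡.sym (alternating w (u ∷ r) [] w u r))) ⟩
  ∑ˡ (λ (w , r) → H w (u ∷ r) (w ∷ u ∷ r)) (picks us)
    ≡⟨ ∑ˡ-map _ _ (picks us) ⟨
  ∑ˡ (λ (w , r) → H w r (w ∷ r)) (map (λ (w , r) → w , u ∷ r) (picks us)) ∎)
  where open ≡-Reasoning

module _ {V : Set a} (M : V → V → ℤ) where

  -- Lists allow rows and columns to be removed without reindexing. For lists of equal length this
  -- is the determinant, by Laplace expansion along the first row.
  minor : List V → List V → ℤ
  minor []       cs = 1ℤ
  minor (v ∷ vs) cs = ∑± (λ c r → M v c * minor vs r) cs

  -- For the two top rows, both are expanded and `∑±-swap` exchanges the two columns; rows further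
  -- down are reached by expanding along those above them.
  minor-alternating : ∀ p {x y rs} cs → minor (p ++ x ∷ y ∷ rs) cs ≡ - minor (p ++ y ∷ x ∷ rs) cs
  minor-alternating []      {x} {y} {rs} cs = begin
    ∑± (λ c r → M x c * ∑± (λ d r′ → M y d * minor rs r′) r) cs
      ≡⟨ ∑±-cong (λ c r → ≡.sym (∑±-*ˡ (M x c) _ r)) cs ⟩
    ∑± (λ c → ∑± (λ d r → M x c * (M y d * minor rs r))) cs
      ≡⟨ ∑±-swap _ cs ⟩
    - ∑± (λ c → ∑± (λ d r → M x d * (M y c * minor rs r))) cs
      ≡⟨ cong -_ (∑±-cong (λ c r → ≡.trans (∑±-cong (λ d r → lemma (M x d) (M y c) _) r) (∑±-*ˡ (M y c) _ r)) cs) ⟩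
    - ∑± (λ c r → M y c * ∑± (λ d r′ → M x d * minor rs r′) r) cs ∎
    where
    open ≡-Reasoning
    lemma : ∀ p q t → p * (q * t) ≡ q * (p * t)
    lemma = solve-∀
  minor-alternating (v ∷ p) cs =
    ≡.trans (∑±-cong (λ c r → ≡.trans (cong (M v c *_) (minor-alternating p r))
                                  (≡.sym (ℤ.neg-distribʳ-* (M v c) _))) cs)
          (∑±-neg _ cs)

  -- The head term of `∑±` belongs to column `m`. A column in `us` also names a row, which
  -- `∑±-picks` brings to the front because minors alternate in their rows.
  minor-expand : ∀ v m us → minor (v ∷ us) (m ∷ us) ≡
    M v m * minor us us - ∑ˡ (λ (w , r) → M v w * minor (w ∷ r) (m ∷ r)) (picks us)
  minor-expand v m us = cong (_-_ (M v m * minor us us))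
    (∑±-picks (λ c r rs → M v c * minor rs (m ∷ r))
      (λ d r p x y rs → ≡.trans (cong (M v d *_) (minor-alternating p (m ∷ r)))
                              (≡.sym (ℤ.neg-distribʳ-* (M v d) _)))
      us)

-- Every column passed over contributes one factor -1, explicit in the powers on the left and hidden
-- in the nested subtractions of `∑±` on the right.
∑-punchIn : ∀ n (f : A → List A → ℤ) (col : Fin (suc n) → A) →
  ∑ (λ j → -1ℤ ^ toℕ j * f (col j) (tabulate (col ∘ punchIn j))) ≡ ∑± f (tabulate col)
∑-punchIn zero    f col = cong₂ _+_ (ℤ.*-identityˡ (f (col Fin.zero) [])) ≡.refl
∑-punchIn (suc n) f col = cong₂ _+_ (ℤ.*-identityˡ (f (col Fin.zero) (tabulate (col ∘ Fin.suc)))) (begin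
  ∑ (λ j → -1ℤ ^ suc (toℕ j) * term j)
    ≡⟨ sum-cong-≗ (λ j → ℤ.*-assoc -1ℤ (-1ℤ ^ toℕ j) (term j)) ⟩
  ∑ (λ j → -1ℤ * (-1ℤ ^ toℕ j * term j))
    ≡⟨ *-distribˡ-sum -1ℤ (λ j → -1ℤ ^ toℕ j * term j) ⟨
  -1ℤ * ∑ (λ j → -1ℤ ^ toℕ j * term j)
    ≡⟨ ℤ.-1*i≡-i _ ⟩
  - ∑ (λ j → -1ℤ ^ toℕ j * term j)
    ≡⟨ cong -_ (∑-punchIn n g (col ∘ Fin.suc)) ⟩
  - ∑± g (tabulate (col ∘ Fin.suc)) ∎)
  where
  open ≡-Reasoning
  g = λ d r → f d (col Fin.zero ∷ r)
  term = λ j → g (col (Fin.suc j)) (tabulate (col ∘ Fin.suc ∘ punchIn j))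

-- `row`, `col` and `N` are arbitrary so that the induction hypothesis applies to the submatrices of
-- the expansion, whose columns are reindexed by `punchIn`.
det≡minor : ∀ {n} {V : Set a} (M : V → V → ℤ) (row col : Fin n → V) {N : Matrix n} →
  (∀ i j → N i j ≡ M (row i) (col j)) → det N ≡ minor M (tabulate row) (tabulate col)
det≡minor {n = zero}  M row col N≡ = ≡.refl
det≡minor {n = suc n} M row col {N} N≡ = ≡.trans
  (sum-cong-≗ λ j → cong (-1ℤ ^ toℕ j *_) (cong₂ _*_ (N≡ Fin.zero j)
    (det≡minor M (row ∘ Fin.suc) (col ∘ punchIn j) (λ i k → N≡ (Fin.suc i) (punchIn j k)))))
  (∑-punchIn n (λ c r → M (row Fin.zero) c * minor M (tabulate (row ∘ Fin.suc)) r) col)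

-- Lists without repetitions, and finite sums

Unique-resp-↭ : ∀ {xs ys : List A} → xs ↭ ys → Unique xs → Unique ys
Unique-resp-↭ = Permutationₛₚ.Unique-resp-↭ (≡.setoid _) ∘ ↭⇒↭ₛ

AllPairs-with-All : ∀ {R : Rel A r} {P : A → Set p} {xs} → All P xs → AllPairs R xs →
  AllPairs (λ x y → R x y × P x × P y) xs
AllPairs-with-All []         []         = []
AllPairs-with-All (px ∷ pxs) (rx ∷ rxs) =
  All.zipWith (λ (r , q) → r , px , q) (rx , pxs) ∷ AllPairs-with-All pxs rxs

∈-picks⁻ : ∀ us {w : A} {r} → (w , r) ∈ picks us → us ↭ w ∷ r
∈-picks⁻ (u ∷ us) (here ≡.refl) = refl
∈-picks⁻ (u ∷ us) (there p) with ∈-map⁻ _ p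
... | (w , r) , q , ≡.refl = trans (prep u (∈-picks⁻ us q)) (swap u w refl)

∈-picks⁺ : ∀ {us} {w : A} → w ∈ us → ∃[ r ] (w , r) ∈ picks us
∈-picks⁺ (here ≡.refl) = _ , here ≡.refl
∈-picks⁺ (there w∈) with ∈-picks⁺ w∈
... | r , p = _ , there (∈-map⁺ _ p)

map-proj₁-picks : ∀ (us : List A) → map proj₁ (picks us) ≡ us
map-proj₁-picks []       = ≡.refl
map-proj₁-picks (u ∷ us) = cong (u ∷_) (≡.trans (≡.sym (map-∘ (picks us))) (map-proj₁-picks us))

lookup-injective : ∀ {R : Rel A r} → Symmetric R → ∀ {xs} → AllPairs (λ x y → ¬ R x y) xs →
  ∀ i j → R (lookup xs i) (lookup xs j) → i ≡ j
lookup-injective R-sym (x# ∷ xs#) Fin.zero    Fin.zero    r = ≡.refl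
lookup-injective R-sym (x# ∷ xs#) Fin.zero    (Fin.suc j) r = contradiction r (All.lookup x# (∈-lookup j))
lookup-injective R-sym (x# ∷ xs#) (Fin.suc i) Fin.zero    r = contradiction (R-sym r) (All.lookup x# (∈-lookup i))
lookup-injective R-sym (x# ∷ xs#) (Fin.suc i) (Fin.suc j) r = cong Fin.suc (lookup-injective R-sym xs# i j r)

-- The index of an element is the one chosen by surjectivity; injectivity makes it independent of
-- the representative.
bijection⇒HasCardinality : ∀ {S : Setoid a ℓ} {m} (from : Fin m → Setoid.Carrier S) →
  (∀ i j → Setoid._≈_ S (from i) (from j) → i ≡ j) →
  (∀ x → ∃[ i ] Setoid._≈_ S x (from i)) → HasCardinality S m
bijection⇒HasCardinality {S = S} from injective surjective = record
  { to        = proj₁ ∘ surjective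
  ; from      = from
  ; to-cong   = λ {x} {y} x≈y → injective _ _
      (S.trans (S.sym (proj₂ (surjective x))) (S.trans x≈y (proj₂ (surjective y))))
  ; from-cong = λ { ≡.refl → S.refl }
  ; inverse   = (λ {i} {y} y≈ → injective _ _ (S.trans (S.sym (proj₂ (surjective y))) y≈))
              , (λ { {x} ≡.refl → S.sym (proj₂ (surjective x)) })
  }
  where module S = Setoid S

Unique-++⁻ : ∀ (xs : List A) {ys} → Unique (xs ++ ys) → Unique xs × Unique ys × Disjoint xs ys
Unique-++⁻ []       u        = [] , u , λ ()
Unique-++⁻ (x ∷ xs) (x∉ ∷ u) with Unique-++⁻ xs u | All.++⁻ xs x∉
... | xs! , ys! , xs#ys | x∉xs , x∉ys = x∉xs ∷ xs! , ys! , λ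
  { (here ≡.refl , x∈ys) → All.lookup x∉ys x∈ys ≡.refl
  ; (there z∈xs  , z∈ys) → xs#ys (z∈xs , z∈ys)
  }

length-filter-∷ : ∀ {P : A → Set p} (P? : Decidable P) x xs →
  + length (filter P? (x ∷ xs)) ≡ (if does (P? x) then 1ℤ else 0ℤ) + + length (filter P? xs)
length-filter-∷ P? x xs with does (P? x)
... | true  = ≡.refl
... | false = ≡.refl

-- The test is written with `≡ᵇ` because `does` of a decision by `ℕ.≟` computes to it.
∑-indicator : ∀ n (g : ℕ → ℤ) {d} → d ℕ.< n →
  ∑ {n} (λ i → g (toℕ i) * (if d ℕ.≡ᵇ toℕ i then 1ℤ else 0ℤ)) ≡ g d
∑-indicator (suc n) g {zero}  _         = begin
  g 0 * 1ℤ + ∑ {n} (λ i → g (suc (toℕ i)) * 0ℤ)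
    ≡⟨ cong₂ _+_ (ℤ.*-identityʳ (g 0)) (sum-cong-≗ {n} (λ i → ℤ.*-zeroʳ (g (suc (toℕ i))))) ⟩
  g 0 + ∑ {n} (λ _ → 0ℤ)
    ≡⟨ cong (_+_ (g 0)) (sum-replicate-zero n) ⟩
  g 0 + 0ℤ
    ≡⟨ ℤ.+-identityʳ (g 0) ⟩
  g 0 ∎
  where open ≡-Reasoning
∑-indicator (suc n) g {suc d} (ℕ.s≤s d<n) = begin
  g 0 * 0ℤ + ∑ {n} (λ i → g (suc (toℕ i)) * (if d ℕ.≡ᵇ toℕ i then 1ℤ else 0ℤ))
    ≡⟨ cong₂ _+_ (ℤ.*-zeroʳ (g 0)) (∑-indicator n (g ∘ suc) d<n) ⟩
  0ℤ + g (suc d)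
    ≡⟨ ℤ.+-identityˡ (g (suc d)) ⟩
  g (suc d) ∎
  where open ≡-Reasoning

-- The two summations are exchanged by induction on the list, as each entry contributes to a single
-- size. The bounds place that size among the values `suc (toℕ i)`.
∑ˡ-by-size : ∀ (size : A → ℕ) (g : ℕ → ℤ) n xs → (∀ {x} → x ∈ xs → 1 ℕ.≤ size x × size x ℕ.≤ n) →
  ∑ˡ (g ∘ size) xs ≡
  ∑ {n} (λ i → g (suc (toℕ i)) * + length (filter (λ x → size x ℕ.≟ suc (toℕ i)) xs))
∑ˡ-by-size size g n []       bounds = ≡.sym (≡.trans
  (sum-cong-≗ {n} (λ i → ℤ.*-zeroʳ (g (suc (toℕ i))))) (sum-replicate-zero n))
∑ˡ-by-size size g n (x ∷ xs) bounds = ≡.sym (begin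
  ∑ {n} (λ i → g (suc (toℕ i)) * + length (filter (λ y → size y ℕ.≟ suc (toℕ i)) (x ∷ xs)))
    ≡⟨ sum-cong-≗ {n} (λ i → ≡.trans
         (cong (g (suc (toℕ i)) *_) (length-filter-∷ (λ y → size y ℕ.≟ suc (toℕ i)) x xs))
         (ℤ.*-distribˡ-+ (g (suc (toℕ i))) (δ (size x) i) (c i))) ⟩
  ∑ {n} (λ i → g (suc (toℕ i)) * δ (size x) i + g (suc (toℕ i)) * c i)
    ≡⟨ ∑-distrib-+ {n} (λ i → g (suc (toℕ i)) * δ (size x) i) (λ i → g (suc (toℕ i)) * c i) ⟩
  ∑ {n} (λ i → g (suc (toℕ i)) * δ (size x) i) + ∑ {n} (λ i → g (suc (toℕ i)) * c i)
    ≡⟨ cong₂ _+_ (uncurry (pick (size x)) (bounds (here ≡.refl)))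
                 (≡.sym (∑ˡ-by-size size g n xs (bounds ∘ there))) ⟩
  g (size x) + ∑ˡ (g ∘ size) xs ∎)
  where
  open ≡-Reasoning
  δ : ℕ → Fin n → ℤ
  δ m i = if m ℕ.≡ᵇ suc (toℕ i) then 1ℤ else 0ℤ
  c : Fin n → ℤ
  c i = + length (filter (λ y → size y ℕ.≟ suc (toℕ i)) xs)
  pick : ∀ m → 1 ℕ.≤ m → m ℕ.≤ n → ∑ {n} (λ i → g (suc (toℕ i)) * δ m i) ≡ g m
  pick (suc d) _ d<n = ∑-indicator n (g ∘ suc) d<n

-1^n*-1^n≡1 : ∀ n → -1ℤ ^ n * -1ℤ ^ n ≡ 1ℤ
-1^n*-1^n≡1 zero    = ≡.refl
-1^n*-1^n≡1 (suc n) = ≡.trans (lemma (-1ℤ ^ n)) (-1^n*-1^n≡1 n)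
  where
  lemma : ∀ s → -1ℤ * s * (-1ℤ * s) ≡ s * s
  lemma = solve-∀

-1^n*-1^s≡-1^[n∸s] : ∀ {n s} → s ℕ.≤ n → -1ℤ ^ n * -1ℤ ^ s ≡ -1ℤ ^ (n ℕ.∸ s)
-1^n*-1^s≡-1^[n∸s] {n}     ℕ.z≤n       = ℤ.*-identityʳ (-1ℤ ^ n)
-1^n*-1^s≡-1^[n∸s] {suc n} {suc s} (ℕ.s≤s s≤n) =
  ≡.trans (lemma (-1ℤ ^ n) (-1ℤ ^ s)) (-1^n*-1^s≡-1^[n∸s] s≤n)
  where
  lemma : ∀ s t → -1ℤ * s * (-1ℤ * t) ≡ s * t
  lemma = solve-∀

-- Canonical cycle covers

module Enumeration {v e} (G : Digraph v e)
  (arcs : Digraph.Vertex G → Digraph.Vertex G → List (Digraph.Edge G))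
  (∈-arcs⁻ : ∀ {u w f} → f ∈ arcs u w → Digraph.source G f ≡ u × Digraph.target G f ≡ w)
  (∈-arcs⁺ : ∀ f → f ∈ arcs (Digraph.source G f) (Digraph.target G f))
  (arcs-unique : ∀ u w → Unique (arcs u w))
  where

  open Digraph G

  -- The first component is the rest of the cycle under construction, the second holds the cycles
  -- listed after it.
  Partial : Set e
  Partial = List Edge × List (List Edge)

  traversed : Partial → List Edge
  traversed (es , Ds) = es ++ concat Ds

  infixr 5 _◃_
  _◃_ : Edge → Partial → Partial
  f ◃ (es , Ds) = f ∷ es , Ds

  -- `completions k v m us` lists the ways to close a cycle begun at m whose
  -- current end is v, together with a cover of the vertices in us not used for
  -- that; in a continuation the next vertex w has been chosen, but not the edge
  -- to it.  The number k is fuel; the lists are exhaustive if k = length us.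
  covers        : ℕ → List Vertex → List (List (List Edge))
  completions   : ℕ → Vertex → Vertex → List Vertex → List Partial
  continuations : ℕ → Vertex → List Vertex → List (Vertex × List Partial)
  extensions    : ℕ → Vertex → List Vertex → List (Vertex × List Partial)

  covers k       []       = [] ∷ []
  covers zero    (u ∷ us) = []
  covers (suc k) (u ∷ us) = map (uncurry _∷_) (completions k u u us)

  completions k v m us =
    concatMap (λ (w , xs) → cartesianProductWith _◃_ (arcs v w) xs) (continuations k m us)

  continuations k m us = (m , map ([] ,_) (covers k us)) ∷ extensions k m us

  extensions zero    m us = []
  extensions (suc k) m us = map (λ (w , r) → w , completions k w m r) (picks us)

  ∈-completions⁻ : ∀ k v m us {x} → x ∈ completions k v m us →
    ∃₂ λ w xs → (w , xs) ∈ continuations k m us × ∃₂ λ f y → f ∈ arcs v w × y ∈ xs × x ≡ f ◃ y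
  ∈-completions⁻ k v m us p with ∈-concat⁻′ (map _ (continuations k m us)) p
  ... | _ , x∈ , q with ∈-map⁻ _ q
  ... | (w , xs) , c , ≡.refl with ∈-cartesianProductWith⁻ _◃_ (arcs v w) xs x∈
  ... | f , y , f∈ , y∈ , eq = w , xs , c , f , y , f∈ , y∈ , eq

  ∈-completions⁺ : ∀ k v m us {w xs f y} →
    (w , xs) ∈ continuations k m us → f ∈ arcs v w → y ∈ xs → f ◃ y ∈ completions k v m us
  ∈-completions⁺ k v m us c f∈ y∈ =
    ∈-concat⁺′ (∈-cartesianProductWith⁺ _◃_ f∈ y∈) (∈-map⁺ _ c)

  -- Soundness of the enumeration

  data Walk : Vertex → List Edge → Vertex → Set (v ⊔ e) where
    []  : ∀ {u} → Walk u [] u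
    _∷_ : ∀ {u es} f → Walk (target f) es u → Walk (source f) (f ∷ es) u

  data Closed : List Edge → Set (v ⊔ e) where
    closed : ∀ {f es} → Walk (source f) (f ∷ es) (source f) → Closed (f ∷ es)

  -- If `us` has no repetitions, the single permutation encodes that the cycles are simple, that
  -- they are disjoint and that they cover `us`.
  ValidCover : List Vertex → List (List Edge) → Set (v ⊔ e)
  ValidCover us Ds = All Closed Ds × map source (concat Ds) ↭ us

  ValidPartial : Vertex → Vertex → List Vertex → Partial → Set (v ⊔ e)
  ValidPartial u m us x@(es , Ds) = Walk u es m × All Closed Ds × map source (traversed x) ↭ us

  covers-valid : ∀ k us {Ds} → Ds ∈ covers k us → ValidCover us Ds
  -- A vertex is recorded as the source of the edge that leaves it, so the current end `v` still
  -- counts among the vertices to come.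
  completions-valid : ∀ k v m us {x} → x ∈ completions k v m us → ValidPartial v m (v ∷ us) x
  continuations-valid : ∀ k m us {w xs y} → (w , xs) ∈ continuations k m us → y ∈ xs →
    ValidPartial w m us y

  covers-valid k       []       (here ≡.refl) = [] , refl
  covers-valid (suc k) (u ∷ us) p with ∈-map⁻ _ p
  ... | x , x∈ , ≡.refl with ∈-completions⁻ k u u us x∈ | completions-valid k u u us x∈
  ... | w , xs , c , f , y , f∈ , y∈ , ≡.refl | walk@(_ ∷ _) , cs , perm = closed walk ∷ cs , perm

  completions-valid k v m us x∈ with ∈-completions⁻ k v m us x∈
  ... | w , xs , c , f , y , f∈ , y∈ , ≡.refl with ∈-arcs⁻ f∈ | continuations-valid k m us c y∈
  ... | ≡.refl , ≡.refl | walk , cs , perm = f ∷ walk , cs , prep v perm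

  continuations-valid k m us (here ≡.refl) y∈ with ∈-map⁻ _ y∈
  ... | Ds , Ds∈ , ≡.refl with covers-valid k us Ds∈
  ... | cs , perm = [] , cs , perm
  continuations-valid (suc k) m us (there c) y∈ with ∈-map⁻ _ c
  ... | (w , r) , q , ≡.refl with completions-valid k w m r y∈
  ... | walk , cs , perm = walk , cs , trans perm (↭-sym (∈-picks⁻ us q))

  -- Distinctness of the enumerated covers

  Distinct : Rel Partial e
  Distinct x y = ¬ (traversed x ↭ traversed y)

  -- Only the first edge starts at v, so it can be recovered from the edge set.
  distinct-first-edge : ∀ {v us f f′} x y → Unique (v ∷ us) → source f ≡ v → source f′ ≡ v →
    f ≢ f′ → map source (traversed y) ↭ us → Distinct (f ◃ x) (f′ ◃ y)
  distinct-first-edge x y uniq ≡.refl s′ f≢f′ perm p with ∈-resp-↭ p (here ≡.refl)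
  ... | here f≡f′ = f≢f′ f≡f′
  ... | there f∈  = Unique[x∷xs]⇒x∉xs uniq (∈-resp-↭ perm (∈-map⁺ source f∈))

  -- A common first edge cancels from the permutation; different first edges are handled by
  -- `distinct-first-edge`.
  cartesianProduct-distinct : ∀ {v us} fs {xs} → Unique (v ∷ us) → Unique fs →
    (∀ {f} → f ∈ fs → source f ≡ v) → (∀ {y} → y ∈ xs → map source (traversed y) ↭ us) →
    AllPairs Distinct xs → AllPairs Distinct (cartesianProductWith _◃_ fs xs)
  cartesianProduct-distinct []       uniq _          src perm xs# = []
  cartesianProduct-distinct (f ∷ fs) {xs} uniq (f∉ ∷ fs!) src perm xs# =
    AllPairs.++⁺ (AllPairs.map⁺ (AllPairs.map (λ x#y → x#y ∘ drop-∷) xs#))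
      (cartesianProduct-distinct fs uniq fs! (src ∘ there) perm xs#)
      (All.tabulate λ x∈ → All.tabulate λ y∈ → cross x∈ y∈)
    where
    cross : ∀ {x y} → x ∈ map (f ◃_) xs → y ∈ cartesianProductWith _◃_ fs xs → Distinct x y
    cross x∈ y∈ with ∈-map⁻ (f ◃_) x∈ | ∈-cartesianProductWith⁻ _◃_ fs xs y∈
    ... | x , _ , ≡.refl | f′ , y , f′∈ , y∈xs , ≡.refl =
      distinct-first-edge x y uniq (src (here ≡.refl)) (src (there f′∈)) (All.lookup f∉ f′∈) (perm y∈xs)

  continuations-unique : ∀ k m us → Unique (m ∷ us) →
    AllPairs (_≢_ on proj₁) (continuations k m us)
  continuations-unique zero    m us _    = [] ∷ []
  continuations-unique (suc k) m us uniq =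
    AllPairs.map⁻ (subst (λ ws → Unique (m ∷ ws)) (≡.sym eq) uniq)
    where
    eq : map proj₁ (extensions (suc k) m us) ≡ us
    eq = ≡.trans (≡.sym (map-∘ (picks us))) (map-proj₁-picks us)

  -- The edges up to permutation are invariant under rotating and reordering cycles, so different
  -- entries of the list represent inequivalent covers.
  covers-distinct : ∀ k us → Unique us →
    AllPairs (λ Ds Ds′ → ¬ (concat Ds ↭ concat Ds′)) (covers k us)
  -- Different next vertices force different targets of the edge leaving `v`; for the same next
  -- vertex, the edges or the continuations differ. Uniqueness is asked of `v ∷ us` and `m ∷ us`
  -- separately because `v` and `m` coincide when a cycle begins.
  completions-distinct : ∀ k v m us → Unique (v ∷ us) → Unique (m ∷ us) →
    AllPairs Distinct (completions k v m us)
  continuations-distinct : ∀ k m us → Unique (m ∷ us) →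
    ∀ {w xs} → (w , xs) ∈ continuations k m us → AllPairs Distinct xs

  covers-distinct k       []       us! = [] ∷ []
  covers-distinct zero    (u ∷ us) us! = []
  -- By computation `concat (es ∷ Ds)` is `traversed (es , Ds)`.
  covers-distinct (suc k) (u ∷ us) us! = AllPairs.map⁺ (completions-distinct k u u us us! us!)

  completions-distinct k v m us v! m! = AllPairs.concat⁺
    (All.map⁺ (All.tabulate λ {(w , xs)} c →
      cartesianProduct-distinct (arcs v w) v! (arcs-unique v w) (proj₁ ∘ ∈-arcs⁻)
        (proj₂ ∘ proj₂ ∘ continuations-valid k m us c) (continuations-distinct k m us m! c)))
    (AllPairs.map⁺ (AllPairs.map
      (λ (w≢w′ , _ , c′) → All.tabulate λ x∈ → All.tabulate λ y∈ → cross w≢w′ c′ x∈ y∈)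
      (AllPairs-with-All (All.tabulate (λ c → c)) (continuations-unique k m us m!))))
    where
    cross : ∀ {w xs w′ xs′ x y} → w ≢ w′ → (w′ , xs′) ∈ continuations k m us →
      x ∈ cartesianProductWith _◃_ (arcs v w) xs → y ∈ cartesianProductWith _◃_ (arcs v w′) xs′ →
      Distinct x y
    cross {w} {xs} {w′} {xs′} w≢w′ c′ x∈ y∈
      with ∈-cartesianProductWith⁻ _◃_ (arcs v w) xs x∈ | ∈-cartesianProductWith⁻ _◃_ (arcs v w′) xs′ y∈
    ... | f , x , f∈ , _ , ≡.refl | f′ , y , f′∈ , y∈xs , ≡.refl with ∈-arcs⁻ f∈ | ∈-arcs⁻ f′∈
    ... | s , t | s′ , t′ =
      distinct-first-edge x y v! s s′ (λ { ≡.refl → w≢w′ (≡.trans (≡.sym t) t′) })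
        (proj₂ (proj₂ (continuations-valid k m us c′ y∈xs)))

  continuations-distinct k m us (_ ∷ us!) (here ≡.refl) = AllPairs.map⁺ (covers-distinct k us us!)
  continuations-distinct (suc k) m us (m∉ ∷ us!) (there c) with ∈-map⁻ _ c
  ... | (w , r) , q , ≡.refl with ∈-picks⁻ us q
  ... | perm with Unique-resp-↭ perm us! | All-resp-↭ perm m∉
  ... | wr! | _ ∷ m∉r = completions-distinct k w m r wr! (m∉r ∷ AllPairs.tail wr!)

  -- Signed count of the enumerated covers

  sign : List (List Edge) → ℤ
  sign Ds = -1ℤ ^ length Ds

  arcCount : Vertex → Vertex → ℤ
  arcCount u w = + length (arcs u w)

  -- Prepending an edge leaves the list of later cycles unchanged, so parallel edges all contribute
  -- the same sum.
  ∑ˡ-cartesianProduct : ∀ fs xs →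
    ∑ˡ (sign ∘ proj₂) (cartesianProductWith _◃_ fs xs) ≡ + length fs * ∑ˡ (sign ∘ proj₂) xs
  ∑ˡ-cartesianProduct []       xs = ≡.refl
  ∑ˡ-cartesianProduct (f ∷ fs) xs = begin
    ∑ˡ σ (map (f ◃_) xs ++ cartesianProductWith _◃_ fs xs)
      ≡⟨ ∑ˡ-++ σ (map (f ◃_) xs) ⟩
    ∑ˡ σ (map (f ◃_) xs) + ∑ˡ σ (cartesianProductWith _◃_ fs xs)
      ≡⟨ cong₂ _+_ (∑ˡ-map σ (f ◃_) xs) (∑ˡ-cartesianProduct fs xs) ⟩
    ∑ˡ σ xs + + length fs * ∑ˡ σ xs
      ≡⟨ ℤ.suc-* (+ length fs) (∑ˡ σ xs) ⟨
    + suc (length fs) * ∑ˡ σ xs ∎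
    where
    open ≡-Reasoning
    σ = sign ∘ proj₂

  -- The mutual induction mirrors `minor-expand`: the continuation at `m` gives its first term and
  -- `extensions` its sum over `picks`.
  covers-sum : ∀ k us → length us ≡ k → ∑ˡ sign (covers k us) ≡ -1ℤ ^ k * minor arcCount us us
  -- The open cycle affects the sign only when `covers` adds it to the list, so the exponent counts
  -- `us` without `v`.
  completions-sum : ∀ k v m us → length us ≡ k →
    ∑ˡ (sign ∘ proj₂) (completions k v m us) ≡ -1ℤ ^ k * minor arcCount (v ∷ us) (m ∷ us)
  extensions-sum : ∀ k v m us → length us ≡ k →
    ∑ˡ (λ (w , xs) → arcCount v w * ∑ˡ (sign ∘ proj₂) xs) (extensions k m us) ≡
    - (-1ℤ ^ k * ∑ˡ (λ (w , r) → arcCount v w * minor arcCount (w ∷ r) (m ∷ r)) (picks us))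

  covers-sum zero    []       eq = ≡.refl
  covers-sum (suc k) (u ∷ us) eq = begin
    ∑ˡ sign (map (uncurry _∷_) (completions k u u us))
      ≡⟨ ∑ˡ-map sign (uncurry _∷_) (completions k u u us) ⟩
    ∑ˡ (λ x → -1ℤ * sign (proj₂ x)) (completions k u u us)
      ≡⟨ ∑ˡ-*ˡ -1ℤ (sign ∘ proj₂) (completions k u u us) ⟩
    -1ℤ * ∑ˡ (sign ∘ proj₂) (completions k u u us)
      ≡⟨ cong (-1ℤ *_) (completions-sum k u u us (ℕ.suc-injective eq)) ⟩
    -1ℤ * (-1ℤ ^ k * d)
      ≡⟨ ℤ.*-assoc -1ℤ (-1ℤ ^ k) d ⟨
    -1ℤ ^ suc k * d ∎
    where
    open ≡-Reasoning
    d = minor arcCount (u ∷ us) (u ∷ us)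

  completions-sum k v m us eq = begin
    ∑ˡ σ (completions k v m us)
      ≡⟨ ∑ˡ-concatMap σ (λ (w , xs) → cartesianProductWith _◃_ (arcs v w) xs) (continuations k m us) ⟩
    ∑ˡ (λ (w , xs) → ∑ˡ σ (cartesianProductWith _◃_ (arcs v w) xs)) (continuations k m us)
      ≡⟨ ∑ˡ-cong (continuations k m us) (λ {(w , xs)} _ → ∑ˡ-cartesianProduct (arcs v w) xs) ⟩
    arcCount v m * ∑ˡ σ (map ([] ,_) (covers k us)) + E
      ≡⟨ cong₂ (λ s t → arcCount v m * s + t)
           (≡.trans (∑ˡ-map σ ([] ,_) (covers k us)) (covers-sum k us eq))
           (extensions-sum k v m us eq) ⟩
    arcCount v m * (-1ℤ ^ k * minor arcCount us us) + - (-1ℤ ^ k * P)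
      ≡⟨ factor (-1ℤ ^ k) (arcCount v m) (minor arcCount us us) P ⟩
    -1ℤ ^ k * (arcCount v m * minor arcCount us us - P)
      ≡⟨ cong (-1ℤ ^ k *_) (≡.sym (minor-expand arcCount v m us)) ⟩
    -1ℤ ^ k * minor arcCount (v ∷ us) (m ∷ us) ∎
    where
    open ≡-Reasoning
    σ = sign ∘ proj₂
    E = ∑ˡ (λ (w , xs) → arcCount v w * ∑ˡ σ xs) (extensions k m us)
    P = ∑ˡ (λ (w , r) → arcCount v w * minor arcCount (w ∷ r) (m ∷ r)) (picks us)
    factor : ∀ s q d p → q * (s * d) + - (s * p) ≡ s * (q * d - p)
    factor = solve-∀

  extensions-sum zero    v m []  eq = ≡.refl
  extensions-sum (suc k) v m us eq = begin
    ∑ˡ (λ (w , xs) → arcCount v w * ∑ˡ σ xs) (map (λ (w , r) → w , completions k w m r) (picks us))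
      ≡⟨ ∑ˡ-map (λ (w , xs) → arcCount v w * ∑ˡ σ xs) (λ (w , r) → w , completions k w m r) (picks us) ⟩
    ∑ˡ (λ (w , r) → arcCount v w * ∑ˡ σ (completions k w m r)) (picks us)
      ≡⟨ ∑ˡ-cong (picks us) (λ {(w , r)} q → ≡.trans
           (cong (arcCount v w *_) (completions-sum k w m r
             (ℕ.suc-injective (≡.trans (≡.sym (↭-length (∈-picks⁻ us q))) eq))))
           (exchange (arcCount v w) (-1ℤ ^ k) (minor arcCount (w ∷ r) (m ∷ r)))) ⟩
    ∑ˡ (λ (w , r) → -1ℤ ^ k * (arcCount v w * minor arcCount (w ∷ r) (m ∷ r))) (picks us)
      ≡⟨ ∑ˡ-*ˡ (-1ℤ ^ k) (λ (w , r) → arcCount v w * minor arcCount (w ∷ r) (m ∷ r)) (picks us) ⟩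
    -1ℤ ^ k * P
      -- Choosing `w` shortens the list by one vertex; the resulting drop in the exponent supplies
      -- the minus sign of `minor-expand`.
      ≡⟨ flip-sign (-1ℤ ^ k) P ⟩
    - (-1ℤ ^ suc k * P) ∎
    where
    open ≡-Reasoning
    σ = sign ∘ proj₂
    P = ∑ˡ (λ (w , r) → arcCount v w * minor arcCount (w ∷ r) (m ∷ r)) (picks us)
    exchange : ∀ q s d → q * (s * d) ≡ s * (q * d)
    exchange = solve-∀
    flip-sign : ∀ s p → s * p ≡ - (-1ℤ * s * p)
    flip-sign = solve-∀

  -- Closed walks and cycles

  Walk⇒targets : ∀ {u es w} → Walk u es w → u ∷ map target es ≡ map source es ∷ʳ w
  Walk⇒targets []         = ≡.refl
  Walk⇒targets (f ∷ walk) = cong (source f ∷_) (Walk⇒targets walk)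

  -- The equation matches each target with the next source, which up to the starting vertex is the
  -- form of the field `closed` of `Cycle`.
  targets⇒Walk : ∀ {u} es {w} → u ∷ map target es ≡ map source es ∷ʳ w → Walk u es w
  targets⇒Walk []       ≡.refl = []
  targets⇒Walk (f ∷ es) eq with ∷-injective eq
  ... | ≡.refl , eq′ = f ∷ targets⇒Walk es eq′

  Walk-++⁺ : ∀ {u as w bs z} → Walk u as w → Walk w bs z → Walk u (as ++ bs) z
  Walk-++⁺ []         walk′ = walk′
  Walk-++⁺ (f ∷ walk) walk′ = f ∷ Walk-++⁺ walk walk′

  Walk-++⁻ : ∀ {u} as {bs z} → Walk u (as ++ bs) z → ∃[ w ] Walk u as w × Walk w bs z
  Walk-++⁻ []       walk       = _ , [] , walk
  Walk-++⁻ (f ∷ as) (f ∷ walk) with Walk-++⁻ as walk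
  ... | w , walk₁ , walk₂ = w , f ∷ walk₁ , walk₂

  Walk-head : ∀ {u f es w} → Walk u (f ∷ es) w → u ≡ source f
  Walk-head (f ∷ _) = ≡.refl

  open Cycle using (first; rest; edges; vertices; simple)

  closedWalk : (C : Cycle G) → Walk (source (first C)) (edges C) (source (first C))
  closedWalk C = targets⇒Walk (edges C) (cong (source (first C) ∷_)
    (≡.trans (Cycle.closed C) (map-++ source (rest C) _)))

  fromClosedWalk : ∀ f es → Walk (source f) (f ∷ es) (source f) → Unique (map source (f ∷ es)) → Cycle G
  fromClosedWalk f es walk uniq = record
    { first  = f
    ; rest   = es
    ; closed = ≡.trans (proj₂ (∷-injective (Walk⇒targets walk))) (≡.sym (map-++ source es _))
    ; simple = uniq
    }

  -- The closed walk is cut before `f` and its two pieces are traversed in the other order; they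
  -- still fit because the whole walk ends where it began.
  rotate : (C : Cycle G) → ∀ {f} → f ∈ edges C → ∃[ C′ ] edges C ~ edges C′ × first C′ ≡ f
  rotate C {f} f∈ with ∈-∃++ f∈
  ... | as , bs , eq with Walk-++⁻ as (subst (λ es → Walk (source (first C)) es (source (first C))) eq (closedWalk C))
  ... | w , walk₁ , walk₂ with Walk-head walk₂
  ... | ≡.refl =
    fromClosedWalk f (bs ++ as) (Walk-++⁺ walk₂ walk₁)
      (Unique-resp-↭ (map⁺ source (++-comm as (f ∷ bs))) (subst (Unique ∘ map source) eq (simple C)))
    , (as , f ∷ bs , eq , ≡.refl) , ≡.refl

  -- Completeness of the enumeration

  open Permutationₛ (cycleSetoid G) using () renaming (_↭_ to _↭ᶜ_)

  allEdges : List (Cycle G) → List Edge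
  allEdges = concatMap edges

  ~⇒↭ : ∀ {es fs : List Edge} → es ~ fs → es ↭ fs
  ~⇒↭ (as , bs , ≡.refl , ≡.refl) = ++-comm as bs

  -- Rotating a cycle permutes the edges within its block, and reordering the cycles permutes the
  -- blocks.
  allEdges-cong : ∀ {Cs Cs′} → Cs ↭ᶜ Cs′ → allEdges Cs ↭ allEdges Cs′
  allEdges-cong (Permutationₛ.refl pw) = pointwise pw
    where
    pointwise : ∀ {Cs Cs′} → Pointwise (_~_ on edges) Cs Cs′ → allEdges Cs ↭ allEdges Cs′
    pointwise []         = refl
    pointwise (C~ ∷ pw′) = ++⁺ (~⇒↭ C~) (pointwise pw′)
  allEdges-cong (Permutationₛ.prep C~ p) = ++⁺ (~⇒↭ C~) (allEdges-cong p)
  allEdges-cong {C ∷ D ∷ Cs} {D′ ∷ C′ ∷ Cs′} (Permutationₛ.swap C~ D~ p) =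
    trans (shifts (edges C) (edges D)) (++⁺ (~⇒↭ D~) (++⁺ (~⇒↭ C~) (allEdges-cong p)))
  allEdges-cong (Permutationₛ.trans p q) = trans (allEdges-cong p) (allEdges-cong q)

  covers-complete : ∀ k us Cs → length us ≡ k → map source (allEdges Cs) ↭ us →
    ∃[ Cs′ ] Cs ↭ᶜ Cs′ × map edges Cs′ ∈ covers k us
  -- The walk is followed edge by edge: its last edge matches the closing continuation, and any
  -- other edge leads to the source of the next one, which lies in `us`.
  completions-complete : ∀ k {v m} us f es Cs → length us ≡ k → Walk v (f ∷ es) m →
    map source (f ∷ es ++ allEdges Cs) ↭ v ∷ us →
    ∃[ Cs′ ] Cs ↭ᶜ Cs′ × (f ∷ es , map edges Cs′) ∈ completions k v m us

  covers-complete k []       []       eq perm = [] , Permutationₛ.refl [] , here ≡.refl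
  covers-complete k []       (C ∷ Cs) eq perm = contradiction perm ¬x∷xs↭[]
  covers-complete (suc k) (u ∷ us) Cs eq perm
    with ∈-map⁻ source (∈-resp-↭ (↭-sym perm) (here ≡.refl))
  ... | f , f∈ , ≡.refl with ∈-concat⁻′ (map edges Cs) f∈
  ... | _ , f∈C , p with ∈-map⁻ edges p
  ... | C , C∈Cs , ≡.refl with ∈-∃++ C∈Cs | rotate C f∈C
  ... | As , Bs , ≡.refl | C′ , C~C′ , ≡.refl
    with Permutationₛₚ.shift (cycleSetoid G) C~C′ As Bs
  ... | shifted
    with completions-complete k us (first C′) (rest C′) (As ++ Bs) (ℕ.suc-injective eq) (closedWalk C′)
           (trans (map⁺ source (↭-sym (allEdges-cong shifted))) perm)
  ... | Cs′ , q , p′ =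
    C′ ∷ Cs′ ,
    Permutationₛ.trans shifted (Permutationₛ.↭-prep (cycleSetoid G) C′ q) ,
    ∈-map⁺ (λ (es , Ds) → es ∷ Ds) p′

  completions-complete k {v} {m} us f [] Cs eq (f ∷ []) perm
    with covers-complete k us Cs eq (drop-∷ perm)
  ... | Cs′ , q , p = Cs′ , q ,
    ∈-completions⁺ k v m us (here ≡.refl) (∈-arcs⁺ f) (∈-map⁺ ([] ,_) p)
  completions-complete zero    [] f (g ∷ es) Cs eq (f ∷ walk) perm =
    contradiction (drop-∷ perm) ¬x∷xs↭[]
  completions-complete (suc k) {v} {m} us f (g ∷ es) Cs eq (f ∷ walk) perm
    with ∈-picks⁺ (∈-resp-↭ (drop-∷ perm) (here (Walk-head walk)))
  ... | r , q with ∈-picks⁻ us q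
  ... | us↭
    with completions-complete k r g es Cs (ℕ.suc-injective (≡.trans (≡.sym (↭-length us↭)) eq))
           walk (trans (drop-∷ perm) us↭)
  ... | Cs′ , q′ , p = Cs′ , q′ ,
    ∈-completions⁺ (suc k) v m us
      (there (∈-map⁺ (λ (w , r) → w , completions k w m r) q)) (∈-arcs⁺ f) p

  -- Cycle covers as edge lists without repeated sources

  vertex∈⁺ : ∀ {u} Cs → Any (λ C → u ∈ vertices C) Cs → u ∈ map source (allEdges Cs)
  vertex∈⁺ (C ∷ Cs) (here u∈)  with ∈-map⁻ source u∈
  ... | f , f∈ , ≡.refl = ∈-map⁺ source (∈-++⁺ˡ f∈)
  vertex∈⁺ (C ∷ Cs) (there u∈) with ∈-map⁻ source (vertex∈⁺ Cs u∈)
  ... | f , f∈ , ≡.refl = ∈-map⁺ source (∈-++⁺ʳ (edges C) f∈)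

  vertex∈⁻ : ∀ {u} Cs → u ∈ map source (allEdges Cs) → Any (λ C → u ∈ vertices C) Cs
  vertex∈⁻ Cs u∈ with ∈-map⁻ source u∈
  ... | f , f∈ , ≡.refl =
    Any.map (∈-map⁺ source) (Any.map⁻ (∈-concat⁻ (map edges Cs) f∈))

  disjoint⇒unique : ∀ Cs → AllPairs (Disjoint on vertices) Cs → Unique (map source (allEdges Cs))
  disjoint⇒unique Cs disjoint = subst Unique (≡.sym (map-concatMap source edges Cs))
    (concat⁺ (All.map⁺ (All.tabulate (λ {C} _ → simple C))) (AllPairs.map⁺ disjoint))

  unique⇒disjoint : ∀ Cs → Unique (map source (allEdges Cs)) → AllPairs (Disjoint on vertices) Cs
  unique⇒disjoint []       uniq = []
  unique⇒disjoint (C ∷ Cs) uniq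
    with Unique-++⁻ (vertices C) (subst Unique (map-++ source (edges C) (allEdges Cs)) uniq)
  ... | _ , uniq′ , C#Cs =
    All.tabulate (λ D∈ (u∈C , u∈D) → C#Cs (u∈C , vertex∈⁺ Cs (lose D∈ u∈D)))
    ∷ unique⇒disjoint Cs uniq′

  toCycles : ∀ {Ds} → All Closed Ds → Unique (map source (concat Ds)) → ∃[ Cs ] map (edges {G = G}) Cs ≡ Ds
  toCycles []                      uniq = [] , ≡.refl
  toCycles (closed {f} {es} walk ∷ cs) uniq
    with Unique-++⁻ (map source (f ∷ es)) (subst Unique (map-++ source (f ∷ es) _) uniq)
  ... | es! , uniq′ , _ with toCycles cs uniq′
  ... | Cs , ≡.refl = fromClosedWalk f es walk es! ∷ Cs , ≡.refl

  -- Cycles with equal edges may still differ in their proofs of `closed` and `simple`, so the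
  -- conclusion is equivalence rather than equality.
  map-edges-injective : ∀ Cs Cs′ → map edges Cs ≡ map edges Cs′ → Cs ↭ᶜ Cs′
  map-edges-injective Cs Cs′ eq = Permutationₛ.refl (pointwise Cs Cs′ eq)
    where
    pointwise : ∀ Cs Cs′ → map edges Cs ≡ map edges Cs′ → Pointwise (_~_ on edges) Cs Cs′
    pointwise []       []         eq = []
    pointwise (C ∷ Cs) (C′ ∷ Cs′) eq with ∷-injectiveˡ eq | ∷-injectiveʳ eq
    ... | C≡C′ | eq′ = subst (edges C ~_) C≡C′ ~-refl ∷ pointwise Cs Cs′ eq′

  -- Counting covers by their number of cycles

  module _ {n} (vs : List Vertex) (|vs|≡n : length vs ≡ n)
           (vs-unique : Unique vs) (∈vs : ∀ u → u ∈ vs) where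

    coversOfSize : ℕ → List (List (List Edge))
    coversOfSize s = filter (λ Ds → length Ds ℕ.≟ s) (covers n vs)

    toCover : ∀ {s Ds} → Ds ∈ coversOfSize s → ∃[ K ] map edges (CycleCover.cycles {G = G} {s} K) ≡ Ds
    toCover {s} Ds∈ with ∈-filter⁻ (λ Ds → length Ds ℕ.≟ s) Ds∈
    ... | Ds∈′ , size with covers-valid n vs Ds∈′
    ... | cs , perm with Unique-resp-↭ (↭-sym perm) vs-unique
    ... | uniq with toCycles cs uniq
    ... | Cs , ≡.refl = record
      { cycles   = Cs
      ; size     = ≡.trans (≡.sym (length-map edges Cs)) size
      ; disjoint = unique⇒disjoint Cs uniq
      ; covers   = λ u → vertex∈⁻ Cs (∈-resp-↭ (↭-sym perm) (∈vs u))
      } , ≡.refl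

    cycleCovers-cardinality : ∀ s → HasCardinality (cycleCoverSetoid G s) (length (coversOfSize s))
    cycleCovers-cardinality s = bijection⇒HasCardinality {S = cycleCoverSetoid G s} from injective surjective
      where
      open CycleCover using (cycles)

      from : Fin (length (coversOfSize s)) → CycleCover G s
      from i = proj₁ (toCover (∈-lookup i))

      edges-from : ∀ i → map edges (cycles (from i)) ≡ lookup (coversOfSize s) i
      edges-from i = proj₂ (toCover (∈-lookup i))

      injective : ∀ i j → cycles (from i) ↭ᶜ cycles (from j) → i ≡ j
      injective i j p = lookup-injective {R = λ Ds Ds′ → concat Ds ↭ concat Ds′} ↭-sym
        (AllPairs.filter⁺ (λ Ds → length Ds ℕ.≟ s) (covers-distinct n vs vs-unique)) i j
        (subst₂ (λ Ds Ds′ → concat Ds ↭ concat Ds′) (edges-from i) (edges-from j) (allEdges-cong p))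

      -- Both lists are free of repetitions and contain every vertex, so they agree as bags.
      vertices-↭ : (K : CycleCover G s) → map source (allEdges (cycles K)) ↭ vs
      vertices-↭ K = ∼bag⇒↭ (unique∧set⇒bag (disjoint⇒unique (cycles K) (CycleCover.disjoint K)) vs-unique
        (mk⇔ (λ _ → ∈vs _) (λ _ → vertex∈⁺ (cycles K) (CycleCover.covers K _))))

      surjective : ∀ K → ∃[ i ] cycles K ↭ᶜ cycles (from i)
      surjective K with covers-complete n vs (cycles K) |vs|≡n (vertices-↭ K)
      ... | Cs , p , Cs∈ = i , Permutationₛ.trans p (map-edges-injective Cs (cycles (from i))
              (≡.trans (Any.lookup-index Cs∈′) (≡.sym (edges-from i))))
        where
        Cs∈′ : map edges Cs ∈ coversOfSize s
        Cs∈′ = ∈-filter⁺ (λ Ds → length Ds ℕ.≟ s) Cs∈ (≡.trans (length-map edges Cs)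
          (≡.trans (≡.sym (Permutationₛₚ.xs↭ys⇒|xs|≡|ys| (cycleSetoid G) p)) (CycleCover.size K)))
        i = Any.index Cs∈′

    -- A cover has one edge for each of the `n` vertices. As `n` is not zero it has a cycle, and as
    -- cycles are non-empty they cannot outnumber the edges.
    size-bounds : .{{_ : ℕ.NonZero n}} → ∀ {Ds} → Ds ∈ covers n vs → 1 ℕ.≤ length Ds × length Ds ℕ.≤ n
    size-bounds {Ds} Ds∈ with covers-valid n vs Ds∈
    ... | cs , perm = positive Ds size , subst (length Ds ℕ.≤_) size (length≤ cs)
      where
      size : length (concat Ds) ≡ n
      size = ≡.trans (≡.trans (≡.sym (length-map source (concat Ds))) (↭-length perm)) |vs|≡n
      positive : ∀ Ds → length (concat Ds) ≡ n → 1 ℕ.≤ length Ds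
      positive []       0≡n = contradiction (≡.sym 0≡n) (ℕ.≢-nonZero⁻¹ n)
      positive (D ∷ Ds) _   = ℕ.s≤s ℕ.z≤n
      length≤ : ∀ {Ds} → All Closed Ds → length Ds ℕ.≤ length (concat Ds)
      length≤ []                       = ℕ.z≤n
      length≤ (closed {f} {es} _ ∷ cs) = ℕ.s≤s (ℕ.≤-trans (length≤ cs)
        (ℕ.≤-trans (ℕ.m≤n+m _ (length es)) (ℕ.≤-reflexive (≡.sym (length-++ es)))))

    minor≡∑ : .{{_ : ℕ.NonZero n}} → minor arcCount vs vs ≡
      ∑ {n} (λ i → -1ℤ ^ (n ℕ.∸ suc (toℕ i)) * + length (coversOfSize (suc (toℕ i))))
    minor≡∑ = begin
      minor arcCount vs vs
        ≡⟨ ℤ.*-identityˡ _ ⟨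
      1ℤ * minor arcCount vs vs
        -- Of the two factors introduced here, one is absorbed by `covers-sum`; the other turns the
        -- sign of a cover with `s` cycles into the power with exponent `n ∸ s`.
        ≡⟨ cong (_* minor arcCount vs vs) (-1^n*-1^n≡1 n) ⟨
      -1ℤ ^ n * -1ℤ ^ n * minor arcCount vs vs
        ≡⟨ ℤ.*-assoc (-1ℤ ^ n) (-1ℤ ^ n) _ ⟩
      -1ℤ ^ n * (-1ℤ ^ n * minor arcCount vs vs)
        ≡⟨ cong (-1ℤ ^ n *_) (covers-sum n vs |vs|≡n) ⟨
      -1ℤ ^ n * ∑ˡ sign (covers n vs)
        ≡⟨ cong (-1ℤ ^ n *_) (∑ˡ-by-size length (-1ℤ ^_) n (covers n vs) size-bounds) ⟩
      -1ℤ ^ n * ∑ {n} (λ i → -1ℤ ^ suc (toℕ i) * c i)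
        ≡⟨ *-distribˡ-sum (-1ℤ ^ n) (λ (i : Fin n) → -1ℤ ^ suc (toℕ i) * c i) ⟩
      ∑ {n} (λ i → -1ℤ ^ n * (-1ℤ ^ suc (toℕ i) * c i))
        ≡⟨ sum-cong-≗ {n} (λ i → ≡.trans (≡.sym (ℤ.*-assoc (-1ℤ ^ n) (-1ℤ ^ suc (toℕ i)) (c i)))
             -- `toℕ i < n` unfolds to `suc (toℕ i) ≤ n`, as the truncated subtraction requires.
             (cong (_* c i) (-1^n*-1^s≡-1^[n∸s] (toℕ<n i)))) ⟩
      ∑ {n} (λ i → -1ℤ ^ (n ℕ.∸ suc (toℕ i)) * c i) ∎
      where
      open ≡-Reasoning
      c : Fin n → ℤ
      c i = + length (coversOfSize (suc (toℕ i)))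

-- The arcs of D̄ P

module PosetArcs {p ℓ n} (P : LabelledPoset p ℓ n) where
  open LabelledPoset P
  open IsDecPartialOrder isDecPartialOrder using (_≟_; antisym; reflexive)
  open Digraph (D̄ P)

  arcs : Vertex → Vertex → List Edge
  arcs u w with u ≟ w
  ... | yes _   = inj₂ (u , Fin.zero) ∷ inj₂ (u , Fin.suc Fin.zero) ∷ []
  ... | no  u≢w with (u ≤? w) ⊎-dec (w ≤? u)
  ...   | yes u~w = inj₁ (arc u w u≢w u~w) ∷ []
  ...   | no  _   = []

  ∈-arcs⁻ : ∀ {u w f} → f ∈ arcs u w → source f ≡ u × target f ≡ w
  ∈-arcs⁻ {u} {w} f∈ with u ≟ w
  ∈-arcs⁻ (here ≡.refl)         | yes u≡w = ≡.refl , u≡w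
  ∈-arcs⁻ (there (here ≡.refl)) | yes u≡w = ≡.refl , u≡w
  ∈-arcs⁻ {u} {w} f∈            | no  u≢w with (u ≤? w) ⊎-dec (w ≤? u)
  ∈-arcs⁻ (here ≡.refl)         | no  u≢w | yes _ = ≡.refl , ≡.refl

  -- The fields `distinct` and `comparable` are irrelevant: arcs with the same ends are equal by
  -- `refl`, and the impossible cases are refuted by irrelevant elimination.
  ∈-arcs⁺ : ∀ f → f ∈ arcs (source f) (target f)
  ∈-arcs⁺ (inj₁ (arc u w u≢w u~w)) with u ≟ w
  ... | yes u≡w = ⊥-elim-irr (u≢w u≡w)
  ... | no  _   with (u ≤? w) ⊎-dec (w ≤? u)
  ...   | yes _   = here ≡.refl
  ...   | no  u≁w = ⊥-elim-irr (u≁w u~w)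
  ∈-arcs⁺ (inj₂ (u , i)) with u ≟ u
  ∈-arcs⁺ (inj₂ (u , Fin.zero))         | yes _   = here ≡.refl
  ∈-arcs⁺ (inj₂ (u , Fin.suc Fin.zero)) | yes _   = there (here ≡.refl)
  ∈-arcs⁺ (inj₂ (u , i))                | no  u≢u = contradiction ≡.refl u≢u

  arcs-unique : ∀ u w → Unique (arcs u w)
  arcs-unique u w with u ≟ w
  ... | yes _   = ((λ ()) ∷ []) ∷ [] ∷ []
  ... | no  u≢w with (u ≤? w) ⊎-dec (w ≤? u)
  ...   | yes _ = [] ∷ []
  ...   | no  _ = []

  -- On the diagonal reflexivity makes both summands 1, matching the two loops. Off the diagonal
  -- antisymmetry allows at most one summand to be 1, matching the single arc between comparable
  -- elements.
  arcs-count : ∀ u w →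
    (if does (u ≤? w) then 1ℤ else 0ℤ) + (if does (w ≤? u) then 1ℤ else 0ℤ) ≡ + length (arcs u w)
  arcs-count u w with u ≟ w
  arcs-count u w | yes u≡w with u ≤? w | w ≤? u
  ... | yes _   | yes _   = ≡.refl
  ... | no  u≰w | _       = contradiction (reflexive u≡w) u≰w
  ... | yes _   | no  w≰u = contradiction (reflexive (≡.sym u≡w)) w≰u
  arcs-count u w | no  u≢w with u ≤? w | w ≤? u
  ... | yes u≤w | yes w≤u = contradiction (antisym u≤w w≤u) u≢w
  ... | yes _   | no  _   = ≡.refl
  ... | no  _   | yes _   = ≡.refl
  ... | no  _   | no  _   = ≡.refl

theorem2 : ∀ {p ℓ} (n : ℕ) .{{_ : NonZero n}} (P : LabelledPoset p ℓ n) →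
    Σ[ c ∈ (ℕ → ℕ) ] (∀ s → 1 ≤ s → s ≤ n → HasCardinality (cycleCoverSetoid (D̄ P) s) (c s))
    × det (zeta P ⊕ zeta P ᵗ) ≡ ∑ {n} (λ i → let s = suc (toℕ i) in -1ℤ ^ (n ∸ s) * + c s)
theorem2 n P =
    (λ s → length (coversOfSize vs |vs|≡n vs-unique ∈vs s))
  , (λ s _ _ → cycleCovers-cardinality vs |vs|≡n vs-unique ∈vs s)
  -- The entries of the symmetrised zeta matrix are arc counts, so its determinant is the minor with
  -- all elements as rows and columns.
  , ≡.trans (det≡minor arcCount x x (λ i j → arcs-count (x i) (x j)))
            (minor≡∑ vs |vs|≡n vs-unique ∈vs)
  where
  open LabelledPoset P using (Carrier; x; labelling)
  open PosetArcs P
  open Enumeration (D̄ P) arcs ∈-arcs⁻ ∈-arcs⁺ arcs-unique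
  open Inverse labelling using (from; inverseʳ; strictlyInverseˡ; strictlyInverseʳ)

  vs : List Carrier
  vs = tabulate x

  |vs|≡n : length vs ≡ n
  |vs|≡n = length-tabulate x

  vs-unique : Unique vs
  vs-unique = tabulate⁺ (λ {i} xᵢ≡xⱼ → ≡.trans (≡.sym (strictlyInverseʳ i)) (inverseʳ xᵢ≡xⱼ))

  ∈vs : ∀ u → u ∈ vs
  ∈vs u = subst (_∈ vs) (strictlyInverseˡ u) (∈-tabulate⁺ (from u))
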